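{- For every derivation in $\mathsf{SKS}$ with premise $T$ and conclusion $R$ there are structures $V$ and $U$ and a derivation from $T$ to $R$ composed, from top to bottom, of: a derivation from $T$ to $V$ in $\{aw{\uparrow}\}$, a derivation from $V$ to $U$ in $\mathsf{SKS}\setminus\{aw{\downarrow},aw{\uparrow}\}$, and a derivation from $U$ to $R$ in $\{aw{\downarrow}\}$.
   Context: Structures: generated by $S ::= \mathsf f \mid \mathsf t \mid a \mid [S,\dots,S] \mid (S,\dots,S) \mid \bar S$ (non-empty lists), where $a$ ranges over atoms, $\mathsf f,\mathsf t$ are the units false and true, $[\cdot]$ is disjunction, $(\cdot)$ is conjunction, $\bar S$ is negation; the negation of an atom is again an atom. A context $S\{\ \}$ is a structure with one occurrence of a hole, not in the scope of a negation; $S\{R\}$ is the result of filling it with $R$; $S[R,T]$ abbreviates $S\{[R,T]\}$ and $S(R,T)$ abbreviates $S\{(R,T)\}$. Equivalent structures are not distinguished; equivalence is the smallest equivalence relation induced by: $[\vec R,[\vec T],\vec U]=[\vec R,\vec T,\vec U]$ and $(\vec R,(\vec T),\vec U)=(\vec R,\vec T,\vec U)$ (with $\vec R,\vec T,\vec U$ finite sequences, $\vec T$ non-empty); $[R,T]=[T,R]$, $(R,T)=(T,R)$; $(\mathsf f,\mathsf f)=\mathsf f$, $[\mathsf f,R]=R$, $[\mathsf t,\mathsf t]=\mathsf t$, $(\mathsf t,R)=R$; $\bar{\mathsf f}=\mathsf t$, $\bar{\mathsf t}=\mathsf f$, $\overline{[R,T]}=(\bar R,\bar T)$, $\overline{(R,T)}=[\bar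 R,\bar T]$, $\bar{\bar R}=R$; and closure: if $R=T$ then $S\{R\}=S\{T\}$ and $\bar R=\bar T$. A derivation in a system (set of inference rules) is a finite sequence of rule instances, read top-down, the conclusion of each being the premise of the next; it may consist of a single structure. Its premise is the topmost structure, its conclusion the bottommost. System $\mathsf{SKS}$ has the rules (written $\frac{\text{premise}}{\text{conclusion}}$, for atoms $a$, structures $R,T,U,V$ and contexts $S\{\ \}$): $ai{\downarrow}:\frac{S\{\mathsf t\}}{S[a,\bar a]}$, $ai{\uparrow}:\frac{S(a,\bar a)}{S\{\mathsf f\}}$, $s:\frac{S([R,U],T)}{S[(R,T),U]}$, $m:\frac{S[(R,U),(T,V)]}{S([R,T],[U,V])}$, $aw{\downarrow}:\frac{S\{\mathsf f\}}{S\{a\}}$, $aw{\uparrow}:\frac{S\{a\}}{S\{\mathsf t\}}$, $ac{\downarrow}:\frac{S[a,a]}{S\{a\}}$, $ac{\uparrow}:\frac{S\{a\}}{S(a,a)}$. -}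

module Defs where

open import Algebra.Definitions using (Involutive)
open import Data.List.Base using (List; []; _∷_)
open import Data.List.NonEmpty.Base using (List⁺; _∷_; _++⁺_; _⁺++_)
open import Level using (0ℓ)
open import Relation.Binary.PropositionalEquality.Core using (_≡_)
open import Relation.Unary using (Pred; U; _∈_)

-- Negation is not required to be free of fixed points, nor the set of atoms
-- to be infinite; both are allowed.
record Atoms : Set₁ where
  field
    Atom           : Set
    neg            : Atom → Atom
    neg-involutive : Involutive _≡_ neg

open Atoms public

infixr 6 _∨_
infixr 7 _∧_
infix  8 ∼_
infix  9 _⟨_⟩
infix  4 _≈_

-- ⋁ (R₁ ∷ … ∷ Rₙ ∷ []) is [R₁,…,Rₙ] and ⋀ (R₁ ∷ … ∷ Rₙ ∷ []) is (R₁,…,Rₙ).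
data Structure (𝒜 : Atoms) : Set where
  ff tt : Structure 𝒜
  atom  : Atom 𝒜 → Structure 𝒜
  ⋁ ⋀   : List⁺ (Structure 𝒜) → Structure 𝒜
  ∼_    : Structure 𝒜 → Structure 𝒜

_∨_ _∧_ : ∀ {𝒜} → Structure 𝒜 → Structure 𝒜 → Structure 𝒜
R ∨ T = ⋁ (R ∷ T ∷ [])
R ∧ T = ⋀ (R ∷ T ∷ [])

-- There is no constructor for negation: the hole is never in its scope.
data Context (𝒜 : Atoms) : Set where
  hole  : Context 𝒜
  ⋁-ctx : List (Structure 𝒜) → Context 𝒜 → List (Structure 𝒜) → Context 𝒜
  ⋀-ctx : List (Structure 𝒜) → Context 𝒜 → List (Structure 𝒜) → Context 𝒜

_⟨_⟩ : ∀ {𝒜} → Context 𝒜 → Structure 𝒜 → Structure 𝒜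
hole          ⟨ R ⟩ = R
⋁-ctx Ts S Us ⟨ R ⟩ = ⋁ (Ts ++⁺ (S ⟨ R ⟩ ∷ Us))
⋀-ctx Ts S Us ⟨ R ⟩ = ⋀ (Ts ++⁺ (S ⟨ R ⟩ ∷ Us))

data _≈_ {𝒜 : Atoms} : Structure 𝒜 → Structure 𝒜 → Set where
  ≈-refl  : ∀ {R} → R ≈ R
  ≈-sym   : ∀ {R T} → R ≈ T → T ≈ R
  ≈-trans : ∀ {R T V} → R ≈ T → T ≈ V → R ≈ V

  ∨-assoc : ∀ (Rs : List (Structure 𝒜)) (Ts : List⁺ (Structure 𝒜)) (Us : List (Structure 𝒜)) →
            ⋁ (Rs ++⁺ (⋁ Ts ∷ Us)) ≈ ⋁ (Rs ++⁺ (Ts ⁺++ Us))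
  ∧-assoc : ∀ (Rs : List (Structure 𝒜)) (Ts : List⁺ (Structure 𝒜)) (Us : List (Structure 𝒜)) →
            ⋀ (Rs ++⁺ (⋀ Ts ∷ Us)) ≈ ⋀ (Rs ++⁺ (Ts ⁺++ Us))

  ∨-comm  : ∀ R T → R ∨ T ≈ T ∨ R
  ∧-comm  : ∀ R T → R ∧ T ≈ T ∧ R

  ff∧ff   : ff ∧ ff ≈ ff
  ff∨     : ∀ R → ff ∨ R ≈ R
  tt∨tt   : tt ∨ tt ≈ tt
  tt∧     : ∀ R → tt ∧ R ≈ R

  ∼-ff    : ∼ ff ≈ tt
  ∼-tt    : ∼ tt ≈ ff
  -- The negation of an atom is again an atom.
  ∼-atom  : ∀ a → ∼ atom a ≈ atom (neg 𝒜 a)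
  ∼-∨     : ∀ R T → ∼ (R ∨ T) ≈ ∼ R ∧ ∼ T
  ∼-∧     : ∀ R T → ∼ (R ∧ T) ≈ ∼ R ∨ ∼ T
  ∼∼      : ∀ R → ∼ ∼ R ≈ R

  ctx-cong : ∀ S {R T} → R ≈ T → S ⟨ R ⟩ ≈ S ⟨ T ⟩
  ∼-cong   : ∀ {R T} → R ≈ T → ∼ R ≈ ∼ T

data Rule : Set where
  ai↓ ai↑ s m aw↓ aw↑ ac↓ ac↑ : Rule

-- Instance r P Q: P is the premise and Q the conclusion.
data Instance {𝒜 : Atoms} : Rule → Structure 𝒜 → Structure 𝒜 → Set where
  ai↓ : ∀ S a → Instance ai↓ (S ⟨ tt ⟩) (S ⟨ atom a ∨ ∼ atom a ⟩)
  ai↑ : ∀ S a → Instance ai↑ (S ⟨ atom a ∧ ∼ atom a ⟩) (S ⟨ ff ⟩)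
  s   : ∀ S R T U → Instance s (S ⟨ (R ∨ U) ∧ T ⟩) (S ⟨ (R ∧ T) ∨ U ⟩)
  m   : ∀ S R T U V → Instance m (S ⟨ (R ∧ U) ∨ (T ∧ V) ⟩) (S ⟨ (R ∨ T) ∧ (U ∨ V) ⟩)
  aw↓ : ∀ S a → Instance aw↓ (S ⟨ ff ⟩) (S ⟨ atom a ⟩)
  aw↑ : ∀ S a → Instance aw↑ (S ⟨ atom a ⟩) (S ⟨ tt ⟩)
  ac↓ : ∀ S a → Instance ac↓ (S ⟨ atom a ∨ atom a ⟩) (S ⟨ atom a ⟩)
  ac↑ : ∀ S a → Instance ac↑ (S ⟨ atom a ⟩) (S ⟨ atom a ∧ atom a ⟩)

System : Set₁
System = Pred Rule 0ℓ

SKS : System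
SKS = U

-- Derivation 𝒮 T R has premise T and conclusion R.  Equivalent structures are
-- not distinguished, so the one-structure derivation `structure` may present
-- its structure in two equivalent ways, and rules apply up to equivalence.
data Derivation {𝒜 : Atoms} (𝒮 : System) : Structure 𝒜 → Structure 𝒜 → Set where
  structure : ∀ {T R} → T ≈ R → Derivation 𝒮 T R
  step      : ∀ {T P Q R} r → T ≈ P → r ∈ 𝒮 → Instance r P Q →
              Derivation 𝒮 Q R → Derivation 𝒮 T R

-- Work with formulas in negation normal form.  Read a block of atomic weakenings
-- as a single relation: some occurrences of ff are replaced by atoms.  This relation
-- commutes with the equivalence and can be pushed down through every rule; a
-- weakened atom that meets ai↑ turns the ai↑ into an aw↑, and one that meets aw↑
-- leaves a step from ff to tt, which is an instance of s:
-- ff = ([tt,tt],ff) / [(tt,ff),tt] = tt.  Dually, coweakenings are pulled up, where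
-- ai↓ can turn into aw↓.  Pushing down creates no ai↓, and whenever pulling up
-- creates an aw↓ it consumes an ai↓, so alternating the two passes terminates.
module Submission where

open import Defs
open import Data.Bool.Base using (Bool; true; false; not; _xor_; if_then_else_)
open import Data.List.Base using (List; []; _∷_; _++_)
open import Data.List.NonEmpty.Base using (List⁺; _∷_; _++⁺_; _⁺++_; toList)
open import Data.List.Properties using (++-identityʳ)
open import Data.Nat.Base using (ℕ; _+_; _≤_; _<_; z≤n)
open import Data.Nat.Induction using (Acc; acc; <-wellFounded)
open import Data.Nat.Properties
  using (≤-refl; ≤-trans; <⇒≤; <-≤-trans; m≤n+m; +-monoˡ-≤; +-monoˡ-<; +-mono-≤-<)
open import Data.Product using (_×_; _,_; ∃-syntax)
open import Data.Sum.Base using (_⊎_; inj₁; inj₂; [_,_])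
open import Level using (0ℓ)
open import Relation.Binary.PropositionalEquality using (_≡_; _≢_; refl; sym; cong; subst₂)
open import Relation.Unary using (Pred; _∈_; _⊆_; ｛_｝; _∪_; _∖_)

-- Formulas, their equivalence, and deep rewriting

infix 7 _⟪_⟫_ _⊔_ _⊓_
infix 4 _≋_

-- false is disjunctive and true is conjunctive, so that unit b is the neutral
-- element of A ⟪ b ⟫ B and `not` is De Morgan duality.
data Formula (𝒜 : Atoms) : Set where
  unit   : Bool → Formula 𝒜
  lit    : Atom 𝒜 → Formula 𝒜
  _⟪_⟫_  : Formula 𝒜 → Bool → Formula 𝒜 → Formula 𝒜

pattern 𝟎 = unit false
pattern 𝟏 = unit true
pattern _⊔_ A B = A ⟪ false ⟫ B
pattern _⊓_ A B = A ⟪ true ⟫ B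

variable
  𝒜       : Atoms
  A B C D : Formula 𝒜
  R T     : Structure 𝒜
  r       : Rule
  k n     : ℕ
  𝒮 𝒮′    : System

data _≋_ {𝒜} : Formula 𝒜 → Formula 𝒜 → Set where
  ≋-refl     : A ≋ A
  ≋-sym      : A ≋ B → B ≋ A
  ≋-trans    : A ≋ B → B ≋ C → A ≋ C
  ≋-cong     : ∀ b → A ≋ B → C ≋ D → A ⟪ b ⟫ C ≋ B ⟪ b ⟫ D
  ≋-assoc    : ∀ b A B C → (A ⟪ b ⟫ B) ⟪ b ⟫ C ≋ A ⟪ b ⟫ (B ⟪ b ⟫ C)
  ≋-comm     : ∀ b A B → A ⟪ b ⟫ B ≋ B ⟪ b ⟫ A
  ≋-identity : ∀ b A → unit b ⟪ b ⟫ A ≋ A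
  ≋-idem     : ∀ b c → unit c ⟪ b ⟫ unit c ≋ unit c

≋-identityʳ : ∀ b (A : Formula 𝒜) → A ⟪ b ⟫ unit b ≋ A
≋-identityʳ b A = ≋-trans (≋-comm b A (unit b)) (≋-identity b A)

≋-reflexive : A ≡ B → A ≋ B
≋-reflexive refl = ≋-refl

data Redex {𝒜} : Rule → Formula 𝒜 → Formula 𝒜 → Set where
  ai↓ : ∀ a → Redex ai↓ 𝟏 (lit a ⊔ lit (neg 𝒜 a))
  ai↑ : ∀ a → Redex ai↑ (lit a ⊓ lit (neg 𝒜 a)) 𝟎
  s   : ∀ A B C → Redex s ((A ⊔ C) ⊓ B) ((A ⊓ B) ⊔ C)
  m   : ∀ A B C D → Redex m ((A ⊓ C) ⊔ (B ⊓ D)) ((A ⊔ B) ⊓ (C ⊔ D))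
  aw↓ : ∀ a → Redex aw↓ 𝟎 (lit a)
  aw↑ : ∀ a → Redex aw↑ (lit a) 𝟏
  ac↓ : ∀ a → Redex ac↓ (lit a ⊔ lit a) (lit a)
  ac↑ : ∀ a → Redex ac↑ (lit a) (lit a ⊓ lit a)

-- Deep inference without explicit contexts. `under` enters left operands only; right operands are
-- reached by `conv` with commutativity.
data Step {𝒜} (r : Rule) : Formula 𝒜 → Formula 𝒜 → Set where
  redex : Redex r A B → Step r A B
  under : ∀ b C → Step r A B → Step r (A ⟪ b ⟫ C) (B ⟪ b ⟫ C)
  conv  : A ≋ B → Step r B C → C ≋ D → Step r A D

under-right : ∀ b (C : Formula 𝒜) → Step r A B → Step r (C ⟪ b ⟫ A) (C ⟪ b ⟫ B)
under-right b C st = conv (≋-comm b C _) (under b C st) (≋-comm b _ C)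

-- At most one step, since permuting a weakening past a rule may erase the rule instance.
Step? : Pred Rule 0ℓ → Formula 𝒜 → Formula 𝒜 → Set
Step? 𝒮 A B = A ≋ B ⊎ ∃[ r ] (r ∈ 𝒮 × Step r A B)

under? : ∀ b → Step? 𝒮 A B → C ≋ D → Step? 𝒮 (A ⟪ b ⟫ C) (B ⟪ b ⟫ D)
under? b (inj₁ A≋B)            C≋D = inj₁ (≋-cong b A≋B C≋D)
under? b (inj₂ (r , r∈𝒮 , st)) C≋D = inj₂ (r , r∈𝒮 , conv ≋-refl (under b _ st) (≋-cong b ≋-refl C≋D))

conv? : A ≋ B → Step? 𝒮 B C → C ≋ D → Step? 𝒮 A D
conv? A≋B (inj₁ B≋C)            C≋D = inj₁ (≋-trans A≋B (≋-trans B≋C C≋D))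
conv? A≋B (inj₂ (r , r∈𝒮 , st)) C≋D = inj₂ (r , r∈𝒮 , conv A≋B st C≋D)

𝟎-to-𝟏 : Step {𝒜} s 𝟎 𝟏
𝟎-to-𝟏 = conv (≋-sym (≋-trans (≋-cong true (≋-idem false true) ≋-refl) (≋-identity true 𝟎)))
              (redex (s 𝟏 𝟎 𝟏))
              (≋-trans (≋-cong false (≋-identity true 𝟎) ≋-refl) (≋-identity false 𝟏))

-- Blocks of weakenings as a relation compatible with equivalence

-- Weakening false A B is a block of aw↓ from A to B; Weakening true A B is a block
-- of aw↑ from B to A.
data Weakening {𝒜} (u : Bool) : Formula 𝒜 → Formula 𝒜 → Set where
  unit   : ∀ c → Weakening u (unit c) (unit c)
  lit    : ∀ a → Weakening u (lit a) (lit a)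
  weaken : ∀ a → Weakening u (unit u) (lit a)
  _⟪_⟫_  : Weakening u A B → ∀ b → Weakening u C D → Weakening u (A ⟪ b ⟫ C) (B ⟪ b ⟫ D)

weakening-refl : ∀ u (A : Formula 𝒜) → Weakening u A A
weakening-refl u (unit b)    = unit b
weakening-refl u (lit a)     = lit a
weakening-refl u (A ⟪ b ⟫ B) = weakening-refl u A ⟪ b ⟫ weakening-refl u B

weakening-trans : ∀ {u} → Weakening u A B → Weakening u B C → Weakening u A C
weakening-trans (unit c)       w′             = w′
weakening-trans (lit a)        (lit .a)       = lit a
weakening-trans (weaken a)     (lit .a)       = weaken a
weakening-trans (w₁ ⟪ b ⟫ w₂) (w₁′ ⟪ .b ⟫ w₂′) = weakening-trans w₁ w₁′ ⟪ b ⟫ weakening-trans w₂ w₂′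

-- A unit in the second formula can only come from the same unit in the first, so every unit law
-- applicable to the second also applies to the first; the other laws merely rearrange subformulas.
-- The two directions are mutual because `≋-sym` exchanges them.
transport : ∀ {u} → B ≋ C → Weakening u A B → ∃[ D ] (A ≋ D × Weakening u D C)
transport⁻ : ∀ {u} → C ≋ B → Weakening u A B → ∃[ D ] (A ≋ D × Weakening u D C)

transport ≋-refl w = _ , ≋-refl , w
transport (≋-sym e) w = transport⁻ e w
transport (≋-trans e f) w with transport e w
... | _ , e′ , w′ with transport f w′
... | _ , f′ , w″ = _ , ≋-trans e′ f′ , w″
transport (≋-cong b e f) (w ⟪ .b ⟫ v) with transport e w | transport f v
... | _ , e′ , w′ | _ , f′ , v′ = _ , ≋-cong b e′ f′ , w′ ⟪ b ⟫ v′
transport (≋-assoc b _ _ _) ((w ⟪ .b ⟫ v) ⟪ .b ⟫ x) = _ , ≋-assoc b _ _ _ , w ⟪ b ⟫ (v ⟪ b ⟫ x)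
transport (≋-comm b _ _) (w ⟪ .b ⟫ v) = _ , ≋-comm b _ _ , v ⟪ b ⟫ w
transport (≋-identity b _) (unit .b ⟪ .b ⟫ w) = _ , ≋-identity b _ , w
transport (≋-idem b c) (unit .c ⟪ .b ⟫ unit .c) = _ , ≋-idem b c , unit c

transport⁻ ≋-refl w = _ , ≋-refl , w
transport⁻ (≋-sym e) w = transport e w
transport⁻ (≋-trans e f) w with transport⁻ f w
... | _ , f′ , w′ with transport⁻ e w′
... | _ , e′ , w″ = _ , ≋-trans f′ e′ , w″
transport⁻ (≋-cong b e f) (w ⟪ .b ⟫ v) with transport⁻ e w | transport⁻ f v
... | _ , e′ , w′ | _ , f′ , v′ = _ , ≋-cong b e′ f′ , w′ ⟪ b ⟫ v′
transport⁻ (≋-assoc b _ _ _) (w ⟪ .b ⟫ (v ⟪ .b ⟫ x)) = _ , ≋-sym (≋-assoc b _ _ _) , (w ⟪ b ⟫ v) ⟪ b ⟫ x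
transport⁻ (≋-comm b _ _) (w ⟪ .b ⟫ v) = _ , ≋-comm b _ _ , v ⟪ b ⟫ w
transport⁻ (≋-identity b _) w = _ , ≋-sym (≋-identity b _) , unit b ⟪ b ⟫ w
transport⁻ (≋-idem b c) (unit .c) = _ , ≋-sym (≋-idem b c) , unit c ⟪ b ⟫ unit c

Weakening-free : System
Weakening-free = SKS ∖ (｛ aw↓ ｝ ∪ ｛ aw↑ ｝)

ai↓-cost : Rule → ℕ
ai↓-cost ai↓ = 1
ai↓-cost _   = 0

-- Pushing weakenings down and pulling coweakenings up

-- What may remain of an instance of `r` once a weakening has passed it. The cost condition keeps
-- the bound on `ai↓` intact during a push.
After↓ : Rule → Pred Rule 0ℓ
After↓ r r′ = r′ ∈ SKS ∖ ｛ aw↓ ｝ × ai↓-cost r′ ≤ ai↓-cost r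

push-redex : Redex r B C → Weakening false A B → ∃[ D ] (Step? (After↓ r) A D × Weakening false D C)
push-redex (ai↓ a) (unit .true) =
  _ , inj₂ (ai↓ , ((_ , λ ()) , ≤-refl) , redex (ai↓ a)) , weakening-refl _ _
push-redex (ai↑ a) (lit .a ⟪ .true ⟫ lit _) =
  _ , inj₂ (ai↑ , ((_ , λ ()) , z≤n) , redex (ai↑ a)) , unit false
-- Only one atom of the pair is present: `aw↑` turns it into tt, and (tt,ff) = ff.
push-redex (ai↑ a) (lit .a ⟪ .true ⟫ weaken a̅) =
  _ , inj₂ (aw↑ , ((_ , λ ()) , z≤n) , conv ≋-refl (under true 𝟎 (redex (aw↑ a))) (≋-identity true 𝟎)) , unit false
push-redex (ai↑ a) (weaken .a ⟪ .true ⟫ lit a̅) =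
  _ , inj₂ (aw↑ , ((_ , λ ()) , z≤n) , conv ≋-refl (under-right true 𝟎 (redex (aw↑ a̅))) (≋-identityʳ true 𝟎)) , unit false
push-redex (ai↑ a) (weaken .a ⟪ .true ⟫ weaken a̅) =
  _ , inj₁ (≋-idem true false) , unit false
push-redex (s _ _ _) ((w ⟪ .false ⟫ v) ⟪ .true ⟫ x) =
  _ , inj₂ (s , ((_ , λ ()) , z≤n) , redex (s _ _ _)) , (w ⟪ true ⟫ x) ⟪ false ⟫ v
push-redex (m _ _ _ _) ((w ⟪ .true ⟫ v) ⟪ .false ⟫ (x ⟪ .true ⟫ y)) =
  _ , inj₂ (m , ((_ , λ ()) , z≤n) , redex (m _ _ _ _)) , (w ⟪ false ⟫ x) ⟪ true ⟫ (v ⟪ false ⟫ y)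
-- The instance of `aw↓` is absorbed into the block.
push-redex (aw↓ a) (unit .false) = _ , inj₁ ≋-refl , weaken a
push-redex (aw↑ a) (lit .a) =
  _ , inj₂ (aw↑ , ((_ , λ ()) , z≤n) , redex (aw↑ a)) , unit true
push-redex (aw↑ a) (weaken .a) =
  _ , inj₂ (s , ((_ , λ ()) , z≤n) , 𝟎-to-𝟏) , unit true
push-redex (ac↓ a) (lit .a ⟪ .false ⟫ lit .a) =
  _ , inj₂ (ac↓ , ((_ , λ ()) , z≤n) , redex (ac↓ a)) , lit a
push-redex (ac↓ a) (lit .a ⟪ .false ⟫ weaken .a) = _ , inj₁ (≋-identityʳ false _) , lit a
push-redex (ac↓ a) (weaken .a ⟪ .false ⟫ w) = _ , inj₁ (≋-identity false _) , w
push-redex (ac↑ a) (lit .a) =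
  _ , inj₂ (ac↑ , ((_ , λ ()) , z≤n) , redex (ac↑ a)) , lit a ⟪ true ⟫ lit a
-- Duplicating a weakened atom costs no rule: ff = (ff,ff), and both copies are weakened afterwards.
push-redex (ac↑ a) (weaken .a) =
  _ , inj₁ (≋-sym (≋-idem true false)) , weaken a ⟪ true ⟫ weaken a

push-step : Step r B C → Weakening false A B → ∃[ D ] (Step? (After↓ r) A D × Weakening false D C)
push-step (redex ρ) w = push-redex ρ w
push-step (under b _ st) (w ⟪ .b ⟫ v) with push-step st w
... | _ , st′ , w′ = _ , under? b st′ ≋-refl , w′ ⟪ b ⟫ v
push-step (conv e st f) w with transport e w
... | _ , e′ , w₁ with push-step st w₁
... | _ , st′ , w₂ with transport f w₂
... | _ , f′ , w₃ = _ , conv? e′ st′ f′ , w₃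

-- The second alternative admits every rule, in particular `aw↓`, at the price of a strict decrease
-- in cost; this is possible only when `r` is `ai↓`.
After↑ : Rule → Pred Rule 0ℓ
After↑ r r′ = (r′ ∈ Weakening-free × ai↓-cost r′ ≤ ai↓-cost r) ⊎ ai↓-cost r′ < ai↓-cost r

keep : r ∈ SKS ∖ ｛ aw↓ ｝ → aw↑ ≢ r → r ∈ After↑ r
keep (_ , ≢aw↓) ≢aw↑ = inj₁ ((_ , [ ≢aw↓ , ≢aw↑ ]) , ≤-refl)

pull-redex : r ∈ SKS ∖ ｛ aw↓ ｝ → Redex r B C → Weakening true D C →
             ∃[ A ] (Weakening true A B × Step? (After↑ r) A D)
pull-redex r∈ (ai↓ a) (lit .a ⟪ .false ⟫ lit a̅) =
  _ , unit true , inj₂ (ai↓ , keep r∈ (λ ()) , redex (ai↓ a))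
-- Here [a,tt] is needed from tt = [ff,tt], which is one `aw↓`; `≤-refl` proves 0 < 1.
pull-redex r∈ (ai↓ a) (lit .a ⟪ .false ⟫ weaken a̅) =
  _ , unit true , inj₂ (aw↓ , inj₂ ≤-refl , conv (≋-sym (≋-identity false 𝟏)) (under false 𝟏 (redex (aw↓ a))) ≋-refl)
pull-redex r∈ (ai↓ a) (weaken .a ⟪ .false ⟫ lit a̅) =
  _ , unit true , inj₂ (aw↓ , inj₂ ≤-refl , conv (≋-sym (≋-identityʳ false 𝟏)) (under-right false 𝟏 (redex (aw↓ a̅))) ≋-refl)
pull-redex r∈ (ai↓ a) (weaken .a ⟪ .false ⟫ weaken a̅) =
  _ , unit true , inj₁ (≋-sym (≋-idem false true))
pull-redex r∈ (ai↑ a) (unit .false) =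
  _ , weakening-refl _ _ , inj₂ (ai↑ , keep r∈ (λ ()) , redex (ai↑ a))
pull-redex r∈ (s _ _ _) ((w ⟪ .true ⟫ x) ⟪ .false ⟫ v) =
  _ , (w ⟪ false ⟫ v) ⟪ true ⟫ x , inj₂ (s , keep r∈ (λ ()) , redex (s _ _ _))
pull-redex r∈ (m _ _ _ _) ((w ⟪ .false ⟫ x) ⟪ .true ⟫ (v ⟪ .false ⟫ y)) =
  _ , (w ⟪ true ⟫ v) ⟪ false ⟫ (x ⟪ true ⟫ y) , inj₂ (m , keep r∈ (λ ()) , redex (m _ _ _ _))
pull-redex (_ , ≢aw↓) (aw↓ a) w with () ← ≢aw↓ refl
pull-redex r∈ (aw↑ a) (unit .true) = _ , weaken a , inj₁ ≋-refl
pull-redex r∈ (ac↓ a) (lit .a) =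
  _ , lit a ⟪ false ⟫ lit a , inj₂ (ac↓ , keep r∈ (λ ()) , redex (ac↓ a))
pull-redex r∈ (ac↓ a) (weaken .a) =
  _ , weaken a ⟪ false ⟫ weaken a , inj₁ (≋-idem false true)
pull-redex r∈ (ac↑ a) (lit .a ⟪ .true ⟫ lit .a) =
  _ , lit a , inj₂ (ac↑ , keep r∈ (λ ()) , redex (ac↑ a))
pull-redex r∈ (ac↑ a) (lit .a ⟪ .true ⟫ weaken .a) = _ , lit a , inj₁ (≋-sym (≋-identityʳ true _))
pull-redex r∈ (ac↑ a) (weaken .a ⟪ .true ⟫ w) = _ , w , inj₁ (≋-sym (≋-identity true _))

pull-step : r ∈ SKS ∖ ｛ aw↓ ｝ → Step r B C → Weakening true D C →
            ∃[ A ] (Weakening true A B × Step? (After↑ r) A D)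
pull-step r∈ (redex ρ) w = pull-redex r∈ ρ w
pull-step r∈ (under b _ st) (w ⟪ .b ⟫ v) with pull-step r∈ st w
... | _ , w′ , st′ = _ , w′ ⟪ b ⟫ v , under? b st′ ≋-refl
pull-step r∈ (conv e st f) w with transport⁻ f w
... | _ , f′ , w₁ with pull-step r∈ st w₁
... | _ , w₂ , st′ with transport⁻ e w₂
... | _ , e′ , w₃ = _ , w₃ , conv? (≋-sym e′) st′ (≋-sym f′)

-- Separation for formulas

-- The index bounds the number of instances of ai↓.
data Deriv {𝒜} (𝒮 : System) (n : ℕ) : Formula 𝒜 → Formula 𝒜 → Set where
  done : A ≋ B → Deriv 𝒮 n A B
  step : r ∈ 𝒮 → Step r A B → Deriv 𝒮 k B C → ai↓-cost r + k ≤ n → Deriv 𝒮 n A C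

relax : k ≤ n → 𝒮 ⊆ 𝒮′ → Deriv 𝒮 k A B → Deriv 𝒮′ n A B
relax k≤n 𝒮⊆𝒮′ (done e)            = done e
relax k≤n 𝒮⊆𝒮′ (step r∈𝒮 st δ le) = step (𝒮⊆𝒮′ r∈𝒮) st (relax ≤-refl 𝒮⊆𝒮′ δ) (≤-trans le k≤n)

conv-deriv : A ≋ B → Deriv 𝒮 n B C → Deriv 𝒮 n A C
conv-deriv e (done f)           = done (≋-trans e f)
conv-deriv e (step r∈𝒮 st δ le) = step r∈𝒮 (conv e st ≋-refl) δ le

push : Deriv SKS n B C → Weakening false A B →
       ∃[ D ] (Deriv (SKS ∖ ｛ aw↓ ｝) n A D × Weakening false D C)
push (done e) w with transport e w
... | _ , e′ , w′ = _ , done e′ , w′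
push (step {r = r} _ st δ le) w with push-step st w
... | _ , st? , w₁ with push δ w₁ | st?
... | _ , δ′ , w₂ | inj₁ e = _ , conv-deriv e (relax (≤-trans (m≤n+m _ (ai↓-cost r)) le) (λ r∈ → r∈) δ′) , w₂
... | _ , δ′ , w₂ | inj₂ (_ , (r′∈ , r′≤r) , st′) = _ , step r′∈ st′ δ′ (≤-trans (+-monoˡ-≤ _ r′≤r) le) , w₂

-- Either no `aw↓` was created and separation is complete, or some were, and the bound on `ai↓` has
-- dropped, which pays for another round.
Pulled : ℕ → Formula 𝒜 → Formula 𝒜 → Set
Pulled n A B = Deriv Weakening-free n A B ⊎ ∃[ k ] (k < n × Deriv SKS k A B)

pull-cons : Step? (After↑ r) A B → Pulled k B C → ai↓-cost r + k ≤ n → Pulled n A C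
pull-cons {r} {k = k} (inj₁ e) (inj₁ δ) le =
  inj₁ (conv-deriv e (relax (≤-trans (m≤n+m k (ai↓-cost r)) le) (λ r∈ → r∈) δ))
pull-cons {r} {k = k} (inj₁ e) (inj₂ (j , j<k , δ)) le =
  inj₂ (j , <-≤-trans j<k (≤-trans (m≤n+m k (ai↓-cost r)) le) , conv-deriv e δ)
pull-cons (inj₂ (_ , inj₁ (r′∈ , r′≤r) , st)) (inj₁ δ) le =
  inj₁ (step r′∈ st δ (≤-trans (+-monoˡ-≤ _ r′≤r) le))
pull-cons {k = k} (inj₂ (_ , inj₂ r′<r , st)) (inj₁ δ) le =
  inj₂ (_ , <-≤-trans (+-monoˡ-< k r′<r) le , step _ st (relax ≤-refl _ δ) ≤-refl)
-- The tail already brings the strict decrease, so the head only has to be no costlier than before.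
pull-cons {r} (inj₂ (r′ , r′∈ , st)) (inj₂ (_ , j<k , δ)) le =
  inj₂ (_ , <-≤-trans (+-mono-≤-< (r′≤r r′∈) j<k) le , step _ st δ ≤-refl)
  where
  r′≤r : r′ ∈ After↑ r → ai↓-cost r′ ≤ ai↓-cost r
  r′≤r (inj₁ (_ , le)) = le
  r′≤r (inj₂ lt)       = <⇒≤ lt

pull : Deriv (SKS ∖ ｛ aw↓ ｝) n B C → Weakening true D C →
       ∃[ A ] (Weakening true A B × Pulled n A D)
pull (done e) w with transport⁻ e w
... | _ , e′ , w′ = _ , w′ , inj₁ (done (≋-sym e′))
-- Coweakenings rise from the conclusion, so the tail is traversed before the first step.
pull (step r∈ st δ le) w with pull δ w
... | _ , w₁ , pulled with pull-step r∈ st w₁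
... | _ , w₂ , st? = _ , w₂ , pull-cons st? pulled le

separate : Acc _<_ n → Deriv SKS n A B →
           ∃[ C ] ∃[ D ] ∃[ k ] (Weakening true C A × Deriv Weakening-free k C D × Weakening false D B)
-- Each pass starts from an empty block and collects the weakenings it meets.
separate (acc rec) δ with push δ (weakening-refl false _)
... | _ , δ₁ , w↓ with pull δ₁ (weakening-refl true _)
... | _ , w↑ , inj₁ δ₂ = _ , _ , _ , w↑ , δ₂ , w↓
... | _ , w↑ , inj₂ (_ , k<n , δ₂) with separate (rec k<n) δ₂
-- The blocks of the later rounds lie next to the middle part, so they merge with the outer ones.
... | _ , _ , _ , w↑′ , δ₃ , w↓′ = _ , _ , _ , weakening-trans w↑′ w↑ , δ₃ , weakening-trans w↓′ w↓

-- Negation normal form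

-- The polarity p is true under an odd number of negations.
nnf  : Bool → Structure 𝒜 → Formula 𝒜
nnfs : Bool → Bool → List (Structure 𝒜) → Formula 𝒜

nnf p     ff             = unit p
nnf p     tt             = unit (not p)
nnf false (atom a)       = lit a
nnf {𝒜} true (atom a)    = lit (neg 𝒜 a)
nnf p     (⋁ (R ∷ Rs))   = nnf p R ⟪ p ⟫ nnfs p p Rs
nnf p     (⋀ (R ∷ Rs))   = nnf p R ⟪ not p ⟫ nnfs (not p) p Rs
nnf p     (∼ R)          = nnf (not p) R

-- Ending in the neutral unit makes concatenation uniform; `nnf-junction` removes the spare unit
-- from binary junctions.
nnfs b p []       = unit b
nnfs b p (R ∷ Rs) = nnf p R ⟪ b ⟫ nnfs b p Rs

nnfs-++ : ∀ b p (Rs Ts : List (Structure 𝒜)) → nnfs b p (Rs ++ Ts) ≋ nnfs b p Rs ⟪ b ⟫ nnfs b p Ts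
nnfs-++ b p []       Ts = ≋-sym (≋-identity b _)
nnfs-++ b p (R ∷ Rs) Ts = ≋-trans (≋-cong b ≋-refl (nnfs-++ b p Rs Ts)) (≋-sym (≋-assoc b _ _ _))

nnf-junction : ∀ b p (R T : Structure 𝒜) → nnfs b p (R ∷ T ∷ []) ≋ nnf p R ⟪ b ⟫ nnf p T
nnf-junction b p R T = ≋-cong b ≋-refl (≋-identityʳ b _)

-- One induction on contexts serves both `_≋_` and `Step r`.
module _ {𝒜} (_~_ : Formula 𝒜 → Formula 𝒜 → Set)
         (~-under       : ∀ {A B} b C → A ~ B → (A ⟪ b ⟫ C) ~ (B ⟪ b ⟫ C))
         (~-under-right : ∀ {A B} b C → A ~ B → (C ⟪ b ⟫ A) ~ (C ⟪ b ⟫ B)) where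

  nnfs-ctx : ∀ b p Ts Us → nnf p R ~ nnf p T →
             nnfs b p (toList (Ts ++⁺ (R ∷ Us))) ~ nnfs b p (toList (Ts ++⁺ (T ∷ Us)))
  nnfs-ctx b p []       Us e = ~-under b _ e
  nnfs-ctx b p (V ∷ Ts) Us e = ~-under-right b _ (nnfs-ctx b p Ts Us e)

  nnf-ctx : ∀ p S → nnf p R ~ nnf p T → nnf p (S ⟨ R ⟩) ~ nnf p (S ⟨ T ⟩)
  nnf-ctx p hole            e = e
  nnf-ctx p (⋁-ctx Ts S Us) e = nnfs-ctx p p Ts Us (nnf-ctx p S e)
  nnf-ctx p (⋀-ctx Ts S Us) e = nnfs-ctx (not p) p Ts Us (nnf-ctx p S e)

nnf-flatten : ∀ b p (Rs : List (Structure 𝒜)) (Ts : List⁺ (Structure 𝒜)) Us →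
              nnf p R ≋ nnfs b p (toList Ts) →
              nnfs b p (toList (Rs ++⁺ (R ∷ Us))) ≋ nnfs b p (toList (Rs ++⁺ (Ts ⁺++ Us)))
nnf-flatten b p []       Ts Us e =
  ≋-trans (≋-cong b e ≋-refl) (≋-sym (nnfs-++ b p (toList Ts) Us))
nnf-flatten b p (V ∷ Rs) Ts Us e = ≋-cong b ≋-refl (nnf-flatten b p Rs Ts Us e)

-- Both polarities are needed at once, because `∼-cong` flips the polarity. Some cases split on `p`
-- only to let double negations on `Bool` compute.
nnf-≈ : ∀ p → R ≈ T → nnf p R ≋ nnf p T
nnf-≈ p ≈-refl = ≋-refl
nnf-≈ p (≈-sym e) = ≋-sym (nnf-≈ p e)
nnf-≈ p (≈-trans e f) = ≋-trans (nnf-≈ p e) (nnf-≈ p f)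
nnf-≈ p (∨-assoc Rs Ts Us) = nnf-flatten p p Rs Ts Us ≋-refl
nnf-≈ p (∧-assoc Rs Ts Us) = nnf-flatten (not p) p Rs Ts Us ≋-refl
nnf-≈ p (∨-comm R T) =
  ≋-trans (nnf-junction p p R T) (≋-trans (≋-comm p _ _) (≋-sym (nnf-junction p p T R)))
nnf-≈ p (∧-comm R T) =
  ≋-trans (nnf-junction (not p) p R T) (≋-trans (≋-comm (not p) _ _) (≋-sym (nnf-junction (not p) p T R)))
nnf-≈ p ff∧ff = ≋-trans (nnf-junction (not p) p ff ff) (≋-idem (not p) p)
nnf-≈ p (ff∨ R) = ≋-trans (nnf-junction p p ff R) (≋-identity p _)
nnf-≈ p tt∨tt = ≋-trans (nnf-junction p p tt tt) (≋-idem p (not p))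
nnf-≈ p (tt∧ R) = ≋-trans (nnf-junction (not p) p tt R) (≋-identity (not p) _)
nnf-≈ p ∼-ff = ≋-refl
nnf-≈ false ∼-tt = ≋-refl
nnf-≈ true ∼-tt = ≋-refl
nnf-≈ false (∼-atom a) = ≋-refl
-- Under a negation the law compares a with its double negation, hence involutivity.
nnf-≈ {𝒜} true (∼-atom a) = ≋-reflexive (cong lit (sym (neg-involutive 𝒜 a)))
nnf-≈ false (∼-∨ R T) = ≋-refl
nnf-≈ true (∼-∨ R T) = ≋-refl
nnf-≈ false (∼-∧ R T) = ≋-refl
nnf-≈ true (∼-∧ R T) = ≋-refl
nnf-≈ false (∼∼ R) = ≋-refl
nnf-≈ true (∼∼ R) = ≋-refl
nnf-≈ p (ctx-cong S e) =
  nnf-ctx _≋_ (λ b _ e → ≋-cong b e ≋-refl) (λ b _ → ≋-cong b ≋-refl) p S (nnf-≈ p e)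
nnf-≈ p (∼-cong e) = nnf-≈ (not p) e

-- The hole is never under a negation, so the redex keeps polarity `false` and the rule is not
-- dualised.
nnf-instance : Instance r R T → Step r (nnf false R) (nnf false T)
nnf-instance = λ
  { (ai↓ S a) → in-ctx S (conv ≋-refl (redex (ai↓ a)) (≋-sym (nnf-junction _ false (atom a) (∼ atom a))))
  ; (ai↑ S a) → in-ctx S (conv (nnf-junction _ false (atom a) (∼ atom a)) (redex (ai↑ a)) ≋-refl)
  ; (s S R T U) → in-ctx S (conv (nested (R ∨ U) T (nnf-junction _ false R U) ≋-refl)
                                 (redex (s _ _ _))
                                 (≋-sym (nested (R ∧ T) U (nnf-junction _ false R T) ≋-refl)))
  ; (m S R T U V) → in-ctx S (conv (nested (R ∧ U) (T ∧ V) (nnf-junction _ false R U) (nnf-junction _ false T V))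
                                   (redex (m _ _ _ _))
                                   (≋-sym (nested (R ∨ T) (U ∨ V) (nnf-junction _ false R T) (nnf-junction _ false U V))))
  ; (aw↓ S a) → in-ctx S (redex (aw↓ a))
  ; (aw↑ S a) → in-ctx S (redex (aw↑ a))
  ; (ac↓ S a) → in-ctx S (conv (nnf-junction _ false (atom a) (atom a)) (redex (ac↓ a)) ≋-refl)
  ; (ac↑ S a) → in-ctx S (conv ≋-refl (redex (ac↑ a)) (≋-sym (nnf-junction _ false (atom a) (atom a))))
  }
  where
  in-ctx : ∀ S → Step r (nnf false R) (nnf false T) → Step r (nnf false (S ⟨ R ⟩)) (nnf false (S ⟨ T ⟩))
  in-ctx = nnf-ctx (Step _) under under-right false
  nested : ∀ {b} R T → nnf false R ≋ A → nnf false T ≋ B → nnfs b false (R ∷ T ∷ []) ≋ A ⟪ b ⟫ B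
  nested R T e f = ≋-trans (nnf-junction _ false R T) (≋-cong _ e f)

nnf-derivation : Derivation SKS R T → ∃[ n ] Deriv SKS n (nnf false R) (nnf false T)
nnf-derivation (structure e) = 0 , done (nnf-≈ false e)
nnf-derivation (step _ e _ ι δ) with nnf-derivation δ
... | _ , δ′ = _ , step _ (conv (nnf-≈ false e) (nnf-instance ι) ≋-refl) δ′ ≤-refl

-- Formulas as structures

constant : Bool → Structure 𝒜
constant b = if b then tt else ff

junction : Bool → Structure 𝒜 → Structure 𝒜 → Structure 𝒜
junction b R T = if b then R ∧ T else R ∨ T

embed : Formula 𝒜 → Structure 𝒜
embed (unit b)    = constant b
embed (lit a)     = atom a
embed (A ⟪ b ⟫ B) = junction b (embed A) (embed B)

≈-reflexive : R ≡ T → R ≈ T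
≈-reflexive refl = ≈-refl

junction-cong : ∀ b {R R′ T T′ : Structure 𝒜} → R ≈ R′ → T ≈ T′ → junction b R T ≈ junction b R′ T′
junction-cong false e f = ≈-trans (ctx-cong (⋁-ctx [] hole _) e) (ctx-cong (⋁-ctx (_ ∷ []) hole []) f)
junction-cong true  e f = ≈-trans (ctx-cong (⋀-ctx [] hole _) e) (ctx-cong (⋀-ctx (_ ∷ []) hole []) f)

junction-comm : ∀ b (R T : Structure 𝒜) → junction b R T ≈ junction b T R
junction-comm false = ∨-comm
junction-comm true  = ∧-comm

embed-≋ : A ≋ B → embed A ≈ embed B
embed-≋ ≋-refl = ≈-refl
embed-≋ (≋-sym e) = ≈-sym (embed-≋ e)
embed-≋ (≋-trans e f) = ≈-trans (embed-≋ e) (embed-≋ f)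
embed-≋ (≋-cong b e f) = junction-cong b (embed-≋ e) (embed-≋ f)
embed-≋ (≋-assoc false _ _ _) = ≈-trans (∨-assoc [] _ _) (≈-sym (∨-assoc (_ ∷ []) _ []))
embed-≋ (≋-assoc true _ _ _) = ≈-trans (∧-assoc [] _ _) (≈-sym (∧-assoc (_ ∷ []) _ []))
embed-≋ (≋-comm b _ _) = junction-comm b _ _
embed-≋ (≋-identity false _) = ff∨ _
embed-≋ (≋-identity true _) = tt∧ _
embed-≋ (≋-idem false false) = ff∨ ff
embed-≋ (≋-idem false true) = tt∨tt
embed-≋ (≋-idem true false) = ff∧ff
embed-≋ (≋-idem true true) = tt∧ tt

signed : Bool → Structure 𝒜 → Structure 𝒜
signed p R = if p then ∼ R else R

signed-constant : ∀ p b → constant {𝒜} b ≈ signed p (constant (p xor b))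
signed-constant false b     = ≈-refl
signed-constant true  false = ≈-sym ∼-tt
signed-constant true  true  = ≈-sym ∼-ff

-- De Morgan: `p xor b` is the kind of junction before the sign is pushed inside.
signed-junction : ∀ p b (R T : Structure 𝒜) →
                  junction b (signed p R) (signed p T) ≈ signed p (junction (p xor b) R T)
signed-junction false b     R T = ≈-refl
signed-junction true  false R T = ≈-sym (∼-∧ R T)
signed-junction true  true  R T = ≈-sym (∼-∨ R T)

signed-cong : ∀ p → R ≈ T → signed p R ≈ signed p T
signed-cong false e = e
signed-cong true  e = ∼-cong e

junctions : Bool → List (Structure 𝒜) → Structure 𝒜
junctions b     []       = constant b
junctions false (R ∷ Rs) = ⋁ (R ∷ Rs)
junctions true  (R ∷ Rs) = ⋀ (R ∷ Rs)

-- A singleton [R] is R because [R] = [f,[R]] = [f,R] = R.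
junctions-∷ : ∀ b (R : Structure 𝒜) Rs → junction b R (junctions b Rs) ≈ junctions b (R ∷ Rs)
junctions-∷ false R [] =
  ≈-trans (∨-comm R ff) (≈-trans (≈-sym (∨-assoc (ff ∷ []) (R ∷ []) [])) (ff∨ _))
junctions-∷ true R [] =
  ≈-trans (∧-comm R tt) (≈-trans (≈-sym (∧-assoc (tt ∷ []) (R ∷ []) [])) (tt∧ _))
junctions-∷ false R (T ∷ Ts) =
  ≈-trans (∨-assoc (R ∷ []) (T ∷ Ts) []) (≈-reflexive (cong (λ Us → ⋁ (R ∷ T ∷ Us)) (++-identityʳ Ts)))
junctions-∷ true R (T ∷ Ts) =
  ≈-trans (∧-assoc (R ∷ []) (T ∷ Ts) []) (≈-reflexive (cong (λ Us → ⋀ (R ∷ T ∷ Us)) (++-identityʳ Ts)))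

embed-nnf  : ∀ p (R : Structure 𝒜) → embed (nnf p R) ≈ signed p R
embed-nnfs : ∀ b p (Rs : List (Structure 𝒜)) → embed (nnfs b p Rs) ≈ signed p (junctions (p xor b) Rs)
-- Head and tail are separate arguments because each is a subterm of a non-empty junction, whereas
-- the list `R ∷ Rs` is not.
embed-nnfs-∷ : ∀ b p (R : Structure 𝒜) Rs →
               embed (nnf p R ⟪ b ⟫ nnfs b p Rs) ≈ signed p (junctions (p xor b) (R ∷ Rs))

embed-nnf false ff = ≈-refl
embed-nnf true  ff = ≈-sym ∼-ff
embed-nnf false tt = ≈-refl
embed-nnf true  tt = ≈-sym ∼-tt
embed-nnf false (atom a) = ≈-refl
embed-nnf true  (atom a) = ≈-sym (∼-atom a)
embed-nnf false (⋁ (R ∷ Rs)) = embed-nnfs-∷ false false R Rs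
embed-nnf true  (⋁ (R ∷ Rs)) = embed-nnfs-∷ true true R Rs
embed-nnf false (⋀ (R ∷ Rs)) = embed-nnfs-∷ true false R Rs
embed-nnf true  (⋀ (R ∷ Rs)) = embed-nnfs-∷ false true R Rs
embed-nnf false (∼ R) = embed-nnf true R
embed-nnf true  (∼ R) = ≈-trans (embed-nnf false R) (≈-sym (∼∼ R))

embed-nnfs b p []       = signed-constant p b
embed-nnfs b p (R ∷ Rs) = embed-nnfs-∷ b p R Rs

embed-nnfs-∷ b p R Rs =
  ≈-trans (junction-cong b (embed-nnf p R) (embed-nnfs b p Rs))
          (≈-trans (signed-junction p b R _) (signed-cong p (junctions-∷ (p xor b) R Rs)))

-- From derivations on formulas back to derivations on structures

extend : Context 𝒜 → Bool → Structure 𝒜 → Context 𝒜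
extend hole            false T = ⋁-ctx [] hole (T ∷ [])
extend hole            true  T = ⋀-ctx [] hole (T ∷ [])
extend (⋁-ctx Ts S Us) b     T = ⋁-ctx Ts (extend S b T) Us
extend (⋀-ctx Ts S Us) b     T = ⋀-ctx Ts (extend S b T) Us

extend-⟨⟩ : ∀ S b (R T : Structure 𝒜) → extend S b T ⟨ R ⟩ ≡ S ⟨ junction b R T ⟩
extend-⟨⟩ hole            false R T = refl
extend-⟨⟩ hole            true  R T = refl
extend-⟨⟩ (⋁-ctx Ts S Us) b     R T = cong (λ V → ⋁ (Ts ++⁺ (V ∷ Us))) (extend-⟨⟩ S b R T)
extend-⟨⟩ (⋀-ctx Ts S Us) b     R T = cong (λ V → ⋀ (Ts ++⁺ (V ∷ Us))) (extend-⟨⟩ S b R T)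

Instance≈ : Rule → Structure 𝒜 → Structure 𝒜 → Set
Instance≈ r R T = ∃[ P ] ∃[ Q ] (R ≈ P × Instance r P Q × Q ≈ T)

-- The context is general so that `under` can be absorbed by extending it at the hole.
embed-step : Step r A B → ∀ S → Instance≈ r (S ⟨ embed A ⟩) (S ⟨ embed B ⟩)
embed-step (redex (ai↓ a)) S =
  _ , _ , ≈-refl , ai↓ S a , ctx-cong S (junction-cong false ≈-refl (∼-atom a))
embed-step (redex (ai↑ a)) S =
  _ , _ , ctx-cong S (junction-cong true ≈-refl (≈-sym (∼-atom a))) , ai↑ S a , ≈-refl
embed-step (redex (s A B C))   S = _ , _ , ≈-refl , s S (embed A) (embed B) (embed C) , ≈-refl
embed-step (redex (m A B C D)) S = _ , _ , ≈-refl , m S (embed A) (embed B) (embed C) (embed D) , ≈-refl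
embed-step (redex (aw↓ a))     S = _ , _ , ≈-refl , aw↓ S a , ≈-refl
embed-step (redex (aw↑ a))     S = _ , _ , ≈-refl , aw↑ S a , ≈-refl
embed-step (redex (ac↓ a))     S = _ , _ , ≈-refl , ac↓ S a , ≈-refl
embed-step (redex (ac↑ a))     S = _ , _ , ≈-refl , ac↑ S a , ≈-refl
embed-step (under b C st) S =
  subst₂ (Instance≈ _) (extend-⟨⟩ S b _ (embed C)) (extend-⟨⟩ S b _ (embed C)) (embed-step st (extend S b (embed C)))
embed-step (conv e st f) S with embed-step st S
... | _ , _ , e′ , ι , f′ =
  _ , _ , ≈-trans (ctx-cong S (embed-≋ e)) e′ , ι , ≈-trans f′ (ctx-cong S (embed-≋ f))

conv-derivation : ∀ {V} → R ≈ T → Derivation 𝒮 T V → Derivation 𝒮 R V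
conv-derivation e (structure f)      = structure (≈-trans e f)
conv-derivation e (step r f r∈𝒮 ι δ) = step r (≈-trans e f) r∈𝒮 ι δ

_⊙_ : ∀ {V} → Derivation 𝒮 R T → Derivation 𝒮 T V → Derivation 𝒮 R V
structure e         ⊙ ε = conv-derivation e ε
step r e r∈𝒮 ι δ ⊙ ε = step r e r∈𝒮 ι (δ ⊙ ε)

embed-deriv : Deriv 𝒮 n A B → Derivation 𝒮 (embed A) (embed B)
embed-deriv (done e) = structure (embed-≋ e)
embed-deriv (step r∈𝒮 st δ _) with embed-step st hole
... | _ , _ , e , ι , f = step _ e r∈𝒮 ι (conv-derivation f (embed-deriv δ))

-- An abstract relation lets one proof serve derivations read downwards, for `aw↓`, and upwards, for
-- `aw↑`.
module _ {𝒜} (_~_ : Structure 𝒜 → Structure 𝒜 → Set)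
         (~-reflexive : ∀ {R T} → R ≈ T → R ~ T)
         (~-trans     : ∀ {R T V} → R ~ T → T ~ V → R ~ V) where

  embed-weakening : ∀ {u} → (∀ S a → (S ⟨ constant u ⟩) ~ (S ⟨ atom a ⟩)) →
                    Weakening u A B → ∀ S → (S ⟨ embed A ⟩) ~ (S ⟨ embed B ⟩)
  embed-weakening ~-atom (unit c)   S = ~-reflexive ≈-refl
  embed-weakening ~-atom (lit a)    S = ~-reflexive ≈-refl
  embed-weakening ~-atom (weaken a) S = ~-atom S a
  embed-weakening ~-atom (_⟪_⟫_ {A} {B} {C} {D} w b v) S =
    -- The operands are treated one after the other, each while it stands on the left.
    ~-trans (left {C = C} w) (~-trans (swap B C) (~-trans (left {C = B} v) (swap D B)))
    where
    left : ∀ {A B C} → Weakening _ A B →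
           (S ⟨ embed (A ⟪ b ⟫ C) ⟩) ~ (S ⟨ embed (B ⟪ b ⟫ C) ⟩)
    left {C = C} w = subst₂ _~_ (extend-⟨⟩ S b _ _) (extend-⟨⟩ S b _ _)
                       (embed-weakening ~-atom w (extend S b (embed C)))
    swap : ∀ A B → (S ⟨ embed (A ⟪ b ⟫ B) ⟩) ~ (S ⟨ embed (B ⟪ b ⟫ A) ⟩)
    swap A B = ~-reflexive (ctx-cong S (junction-comm b (embed A) (embed B)))

theorem3p36 : ∀ (𝒜 : Atoms) (T R : Structure 𝒜) → Derivation SKS T R →
    ∃[ V ] ∃[ U ] (Derivation ｛ aw↑ ｝ T V
    × Derivation (SKS ∖ (｛ aw↓ ｝ ∪ ｛ aw↑ ｝)) V U
    × Derivation ｛ aw↓ ｝ U R)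
theorem3p36 𝒜 T R δ with nnf-derivation δ
... | n , δ′ with separate (<-wellFounded n) δ′
... | V , U , _ , w↑ , δ″ , w↓ =
  embed V , embed U ,
  conv-derivation (≈-sym (embed-nnf false T))
    -- `Weakening true` points from tt to atoms, against the direction of `aw↑`, so the relation is
    -- reversed.
    (embed-weakening (λ R T → Derivation ｛ aw↑ ｝ T R) (λ e → structure (≈-sym e)) (λ δ ε → ε ⊙ δ)
      (λ S a → step aw↑ ≈-refl refl (aw↑ S a) (structure ≈-refl)) w↑ hole) ,
  embed-deriv δ″ ,
  embed-weakening (Derivation ｛ aw↓ ｝) structure _⊙_
    (λ S a → step aw↓ ≈-refl refl (aw↓ S a) (structure ≈-refl)) w↓ hole
    ⊙ structure (embed-nnf false R)
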